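{- Let $G$ be a finite simple undirected graph which has no induced subgraph isomorphic to any of $C_4$, $C_5$, $C_6$, $S_3$. Then every (nonempty) clique in $G^2$ is contained in a set of the form $N_G[v]$ for some vertex $v$ of $G$.
   Context: All graphs are simple, finite and undirected. $G^2$ is the graph on $V(G)$ in which two distinct vertices are adjacent iff their distance in $G$ is at most $2$. $N_G[v]=\{v\}\cup\{w: vw\in E(G)\}$. $C_n$ is the cycle with $n$ vertices. $S_3$ is the $3$-sun: the graph with six vertices $a_1,a_2,a_3,b_1,b_2,b_3$ in which $a_1,a_2,a_3$ are pairwise adjacent, each $b_i$ is adjacent to exactly the two vertices $a_j$ with $j\neq i$, and there are no other edges. -}

module Defs where

open import Data.Empty using (⊥)
open import Data.Fin.Base using (Fin; toℕ)
import Data.Fin.Properties as Fin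
open import Data.Fin.Subset using (Subset; _∈_; _∪_; ⁅_⁆)
open import Data.Nat.Base using (ℕ; zero; suc; _≤_; s≤s)
import Data.Nat.Properties as ℕ
open import Data.Product.Base using (Σ; ∃; _×_; _,_; proj₁)
open import Data.Sum.Base using (_⊎_; inj₁; inj₂; swap)
open import Data.Vec.Base using (tabulate)
open import Function.Base using (_∘_)
open import Function.Bundles using (_↔_; _⇔_; Inverse)
open import Relation.Binary.Core using (Rel)
open import Relation.Binary.Definitions using (Symmetric; Decidable)
open import Relation.Binary.PropositionalEquality using (_≡_; _≢_; refl; sym)
open import Relation.Nullary.Decidable
  using (Dec; yes; no; does; map′; True; toWitness; ¬?; _×-dec_; _⊎-dec_)
open import Relation.Nullary.Negation using (¬_)
open import Level using (0ℓ)

-- A finite graph is taken to have vertex type Fin n. Decidability of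
-- adjacency is part of the data, as is automatic classically.
record Graph (V : Set) : Set₁ where
  field
    _~_      : Rel V 0ℓ
    ~-sym    : Symmetric _~_
    ~-irrefl : ∀ {v} → ¬ (v ~ v)
    _~?_     : Decidable _~_

_[_~_] : ∀ {V} → Graph V → V → V → Set
G [ u ~ v ] = Graph._~_ G u v

-- The subgraph of G induced by S. Membership proofs are unique, so the
-- vertex type has exactly the elements of S.
induced : ∀ {n} → Graph (Fin n) → (S : Subset n) → Graph (∃ λ v → v ∈ S)
induced G S = record
  { _~_      = λ u v → proj₁ u ~ proj₁ v
  ; ~-sym    = ~-sym
  ; ~-irrefl = ~-irrefl
  ; _~?_     = λ u v → proj₁ u ~? proj₁ v
  } where open Graph G

_≅_ : ∀ {V W} → Graph V → Graph W → Set
_≅_ {V} {W} G H =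
  Σ (V ↔ W) λ φ → ∀ u v → G [ u ~ v ] ⇔ H [ Inverse.to φ u ~ Inverse.to φ v ]

_isFreeOf_ : ∀ {n W} → Graph (Fin n) → Graph W → Set
G isFreeOf H = ∀ S → ¬ (induced G S ≅ H)

IsClique : ∀ {n} → Graph (Fin n) → Subset n → Set
IsClique G K = ∀ {u v} → u ∈ K → v ∈ K → u ≢ v → G [ u ~ v ]

N[_] : ∀ {n} → Graph (Fin n) → Fin n → Subset n
N[ G ] v = ⁅ v ⁆ ∪ tabulate (λ w → does (v ~? w))
  where open Graph G

data Walk {V} (G : Graph V) : V → V → ℕ → Set where
  []  : ∀ {u} → Walk G u u 0
  _∷_ : ∀ {u v w k} → G [ u ~ v ] → Walk G v w k → Walk G u w (suc k)

-- No d satisfies this when u and v lie in different components.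
IsDistance : ∀ {V} → Graph V → V → V → ℕ → Set
IsDistance G u v d = Walk G u v d × (∀ {k} → Walk G u v k → d ≤ k)

Distance≤ : ∀ {V} → Graph V → ℕ → V → V → Set
Distance≤ G m u v = ∃ λ d → d ≤ m × IsDistance G u v d

module _ {V} (G : Graph V) where
  open Graph G

  snoc : ∀ {u v w k} → Walk G u v k → v ~ w → Walk G u w (suc k)
  snoc []      e = e ∷ []
  snoc (f ∷ p) e = f ∷ snoc p e

  reverse : ∀ {u v k} → Walk G u v k → Walk G v u k
  reverse []      = []
  reverse (e ∷ p) = snoc (reverse p) (~-sym e)

module _ {n} (G : Graph (Fin n)) where
  open Graph G

  walk? : ∀ k u v → Dec (Walk G u v k)
  walk? zero    u v = map′ (λ { refl → [] }) (λ { [] → refl }) (u Fin.≟ v)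
  walk? (suc k) u w = map′ (λ (_ , e , p) → e ∷ p) (λ { (e ∷ p) → _ , e , p })
    (Fin.any? λ v → (u ~? v) ×-dec walk? k v w)

  isDistance? : ∀ u v d → Dec (IsDistance G u v d)
  isDistance? u v d = walk? d u v ×-dec
    map′ (λ none {k} p → ℕ.≮⇒≥ (λ k<d → none {k} k<d p))
         (λ min {k} k<d p → ℕ.<⇒≱ k<d (min p))
         (ℕ.allUpTo? (λ k → ¬? (walk? k u v)) d)

  distance≤? : ∀ m u v → Dec (Distance≤ G m u v)
  distance≤? m u v = map′ (λ { (d , s≤s d≤m , δ) → d , d≤m , δ })
                          (λ (d , d≤m , δ) → d , s≤s d≤m , δ)
    (ℕ.anyUpTo? (isDistance? u v) (suc m))

_² : ∀ {n} → Graph (Fin n) → Graph (Fin n)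
G ² = record
  { _~_      = λ u v → u ≢ v × Distance≤ G 2 u v
  ; ~-sym    = λ (u≢v , d , d≤2 , p , min) →
      u≢v ∘ sym , d , d≤2 , reverse G p , λ q → min (reverse G q)
  ; ~-irrefl = λ (v≢v , _) → v≢v refl
  ; _~?_     = λ u v → ¬? (u Fin.≟ v) ×-dec distance≤? G 2 u v
  }

-- j follows i in the cyclic order 0, 1, …, n - 1, 0.
_⋖_ : ∀ {n} → Fin n → Fin n → Set
_⋖_ {n} i j = toℕ j ≡ suc (toℕ i) ⊎ (suc (toℕ i) ≡ n × toℕ j ≡ 0)

C : ∀ n {3≤n : True (3 ℕ.≤? n)} → Graph (Fin n)
C n {3≤n} = record
  { _~_      = λ i j → i ⋖ j ⊎ j ⋖ i
  ; ~-sym    = swap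
  ; ~-irrefl = λ { (inj₁ i⋖i) → ⋖-irrefl i⋖i ; (inj₂ i⋖i) → ⋖-irrefl i⋖i }
  ; _~?_     = λ i j → (i ⋖? j) ⊎-dec (j ⋖? i)
  }
  where
  _⋖?_ : Decidable (_⋖_ {n})
  i ⋖? j = (toℕ j ℕ.≟ suc (toℕ i)) ⊎-dec
           ((suc (toℕ i) ℕ.≟ n) ×-dec (toℕ j ℕ.≟ 0))

  1≢n : ∀ {m} → 3 ≤ m → 1 ≢ m
  1≢n (s≤s ()) refl

  ⋖-irrefl : ∀ {i : Fin n} → ¬ (i ⋖ i)
  ⋖-irrefl (inj₁ i≡1+i)         = ℕ.1+n≢n (sym i≡1+i)
  ⋖-irrefl (inj₂ (1+i≡n , i≡0)) rewrite i≡0 = 1≢n (toWitness 3≤n) 1+i≡n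

data SunVertex : Set where
  a b : Fin 3 → SunVertex

S₃ : Graph SunVertex
S₃ = record
  { _~_      = _~_
  ; ~-sym    = λ {u} {v} → ~-sym u v
  ; ~-irrefl = λ {v} → ~-irrefl v
  ; _~?_     = _~?_
  }
  where
  _~_ : SunVertex → SunVertex → Set
  a i ~ a j = i ≢ j
  a i ~ b j = i ≢ j
  b i ~ a j = i ≢ j
  b i ~ b j = ⊥

  ~-sym : ∀ u v → u ~ v → v ~ u
  ~-sym (a i) (a j) i≢j = i≢j ∘ sym
  ~-sym (a i) (b j) i≢j = i≢j ∘ sym
  ~-sym (b i) (a j) i≢j = i≢j ∘ sym

  ~-irrefl : ∀ v → ¬ (v ~ v)
  ~-irrefl (a i) i≢i = i≢i refl

  _~?_ : Decidable _~_
  a i ~? a j = ¬? (i Fin.≟ j)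
  a i ~? b j = ¬? (i Fin.≟ j)
  b i ~? a j = ¬? (i Fin.≟ j)
  b i ~? b j = no λ ()

-- A clique of G² is a set of vertices whose closed neighbourhoods pairwise
-- meet, so the claim is that closed neighbourhoods have the Helly property.
-- Suppose, by induction, that among x, y, z, … any two of x, y, z together with
-- the remaining vertices are dominated: u dominates all but x, v all but y and
-- w all but z. If none of u, v, w dominates everything, then x w y u z v is a
-- closed walk of length 6 in which opposite vertices are distinct and
-- nonadjacent. In a graph without induced C₄ and C₅, a chord of such a walk
-- forces an induced S₃, and without a chord it is an induced C₆.

module Submission where

open import Defs
open import Data.Bool.Base using (Bool; true; false; if_then_else_)
open import Data.Empty using (⊥; ⊥-elim)
open import Data.Fin.Base using (Fin; zero; suc)
import Data.Fin.Properties as Fin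
open import Data.Fin.Subset using (Subset; Nonempty; _⊆_; _∈_)
open import Data.Fin.Subset.Properties using (_∈?_; x∈⁅x⁆; x∈p∪q⁺)
open import Data.List.Base using (List; []; _∷_; allFin; filter)
import Data.List.Membership.Propositional as List
open import Data.List.Membership.Propositional.Properties
  using (∈-AllPairs₂; ∈-allFin; ∈-filter⁺)
open import Data.List.Relation.Unary.All as All using (All; []; _∷_)
open import Data.List.Relation.Unary.All.Properties using (all-filter)
open import Data.List.Relation.Unary.AllPairs.Core using (AllPairs; []; _∷_)
open import Data.List.Relation.Unary.Any as Any using (here; there)
open import Data.Nat.Base using (ℕ; s≤s)
open import Data.Product.Base using (∃; _×_; _,_; proj₁; proj₂)
open import Data.Sum.Base using (_⊎_; inj₁; inj₂)
open import Data.Vec.Base using (tabulate; lookup; []; _∷_)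
open import Data.Vec.Properties using (lookup∘tabulate; lookup⇒[]=; []=⇒lookup)
open import Data.Vec.Properties.WithK using ([]=-irrelevant)
open import Function.Base using (_∘_)
open import Function.Bundles using (_↔_; _⇔_; Equivalence; mk⇔; mk↔ₛ′)
open import Relation.Binary.Core using (Rel)
open import Relation.Binary.Construct.Closure.Reflexive using (ReflClosure; refl)
  renaming ([_] to edge)
import Relation.Binary.Construct.Closure.Reflexive.Properties as ReflClosure
open import Relation.Binary.Definitions using (Symmetric; Decidable)
open import Relation.Binary.PropositionalEquality
  using (_≡_; refl; sym; trans; subst; subst₂)
open import Relation.Nullary.Decidable
  using (yes; no; does; dec-true; does-⇔)
open import Relation.Nullary.Negation using (¬_; contradiction)
open import Relation.Unary using (Pred)
import Relation.Unary as Unary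
open import Level using (0ℓ)

-- Subsets cut out by decidable predicates

module _ {n} {P : Pred (Fin n) 0ℓ} (P? : Unary.Decidable P) where

  ∈-tabulate⁺ : ∀ {v} → P v → v ∈ tabulate (does ∘ P?)
  ∈-tabulate⁺ {v} p =
    lookup⇒[]= v _ (trans (lookup∘tabulate (does ∘ P?) v) (dec-true (P? v) p))

  ∈-tabulate⁻ : ∀ {v} → v ∈ tabulate (does ∘ P?) → P v
  ∈-tabulate⁻ {v} v∈
    with yes p ← P? v | _ ← trans (sym (lookup∘tabulate (does ∘ P?) v)) ([]=⇒lookup v∈)
    = p

-- Helly's theorem in the form of Berge: triples suffice.
module _ {V : Set} (D : Rel V 0ℓ)
  (triple : ∀ {u v w x y z} → D u y → D u z → D v x → D v z → D w x → D w y →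
            D u x ⊎ D v y ⊎ D w z)
  (P : Pred V 0ℓ) (pair : ∀ {x y} → P x → P y → ∃ λ v → D v x × D v y)
  where

  helly : ∀ {x y zs} → All P (x ∷ y ∷ zs) → ∃ λ v → All (D v) (x ∷ y ∷ zs)
  helly {zs = []} (px ∷ py ∷ []) with v , vx , vy ← pair px py = v , vx ∷ vy ∷ []
  helly {zs = z ∷ zs} (px ∷ py ∷ pz ∷ ps)
    with u , uy ∷ uz ∷ us ← helly (py ∷ pz ∷ ps)
       | v , vx ∷ vz ∷ vs ← helly (px ∷ pz ∷ ps)
       | w , wx ∷ wy ∷ ws ← helly (px ∷ py ∷ ps)
    with triple uy uz vx vz wx wy
  ... | inj₁ ux        = u , ux ∷ uy ∷ uz ∷ us
  ... | inj₂ (inj₁ vy) = v , vx ∷ vy ∷ vz ∷ vs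
  ... | inj₂ (inj₂ wz) = w , wx ∷ wy ∷ wz ∷ ws

module _ {n} (G : Graph (Fin n)) where
  open Graph G

  infix 4 _≃_ _≄_ _≃?_

  -- Membership in a closed neighbourhood and its negation. Walks along `_≃_` may pause, so
  -- coinciding vertices need no separate treatment.
  _≃_ _≄_ : Rel (Fin n) 0ℓ
  _≃_ = ReflClosure _~_
  u ≄ v = ¬ (u ≃ v)

  ≃-sym : Symmetric _≃_
  ≃-sym = ReflClosure.sym ~-sym

  ≄-sym : Symmetric _≄_
  ≄-sym u≄v = u≄v ∘ ≃-sym

  _≃?_ : Decidable _≃_
  _≃?_ = ReflClosure.dec Fin._≟_ _~?_

  ≃⇒∈N : ∀ {v w} → v ≃ w → w ∈ N[ G ] v
  ≃⇒∈N refl       = x∈p∪q⁺ (inj₁ (x∈⁅x⁆ _))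
  ≃⇒∈N (edge v~w) = x∈p∪q⁺ (inj₂ (∈-tabulate⁺ (_ ~?_) v~w))

  distance≤2⇒common : ∀ {u v} → Distance≤ G 2 u v → ∃ λ w → w ≃ u × w ≃ v
  distance≤2⇒common (_ , _ , []         , _) = _ , refl , refl
  distance≤2⇒common (_ , _ , e ∷ []     , _) = _ , refl , edge e
  distance≤2⇒common (_ , _ , e ∷ f ∷ [] , _) = _ , edge (~-sym e) , edge f
  distance≤2⇒common (_ , s≤s (s≤s ()) , _ ∷ _ ∷ _ ∷ _ , _)

  -- Nonadjacency is asked for together with distinctness, so that pairwise
  -- links between the vertices of a copy make it injective.
  Link : Bool → Rel (Fin n) 0ℓ
  Link c u v = if c then u ~ v else u ≄ v

  Link-sym : ∀ c → Symmetric (Link c)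
  Link-sym true  = ~-sym
  Link-sym false = ≄-sym

  Link-irrefl : ∀ c {v} → ¬ Link c v v
  Link-irrefl true  = ~-irrefl
  Link-irrefl false ≄ = ≄ refl

  -- Induced copies from pairwise links

  module _ {W} (H : Graph W) (f : W → Fin n) where
    private module H = Graph H

    -- For concrete `H` the `does` computes, so each pair of vertices asks directly for an edge or
    -- for `_≄_`.
    Linked : Rel W 0ℓ
    Linked i j = Link (does (i H.~? j)) (f i) (f j)

    Linked-sym : Symmetric Linked
    Linked-sym {i} {j} l = Link-sym (does (j H.~? i))
      (subst (λ c → Link c (f i) (f j))
             (does-⇔ (mk⇔ H.~-sym H.~-sym) (i H.~? j) (j H.~? i)) l)

    Linked⇒⇔ : ∀ {i j} → Linked i j → f i ~ f j ⇔ H [ i ~ j ]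
    Linked⇒⇔ {i} {j} l with i H.~? j
    ... | yes i~j = mk⇔ (λ _ → i~j) (λ _ → l)
    ... | no  i≁j = mk⇔ (λ e → contradiction (edge e) l) (λ e → contradiction e i≁j)

    -- No vertex is linked to itself, so `f` is injective and its image induces a copy of `H`. By
    -- symmetry of `Linked`, one link per unordered pair suffices.
    free⇒¬AllPairs : G isFreeOf H → ∀ {ws} → (∀ w → w List.∈ ws) →
                     ¬ AllPairs Linked ws
    free⇒¬AllPairs free {ws} complete links = free S (iso , iso-edge)
      where
      linked : ∀ i j → i ≡ j ⊎ Linked i j
      linked i j with ∈-AllPairs₂ links (complete i) (complete j)
      ... | inj₁ i≡j      = inj₁ i≡j
      ... | inj₂ (inj₁ l) = inj₂ l
      ... | inj₂ (inj₂ l) = inj₂ (Linked-sym l)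

      injective : ∀ {i j} → f i ≡ f j → i ≡ j
      injective {i} {j} fi≡fj with linked i j
      ... | inj₁ i≡j = i≡j
      ... | inj₂ l   = contradiction (subst (Link _ (f i)) (sym fi≡fj) l)
                                     (Link-irrefl (does (i H.~? j)))

      adjacent : ∀ i j → f i ~ f j ⇔ H [ i ~ j ]
      adjacent i j with linked i j
      ... | inj₁ refl = mk⇔ (λ e → contradiction e ~-irrefl)
                            (λ e → contradiction e H.~-irrefl)
      ... | inj₂ l    = Linked⇒⇔ l

      -- Searching the complete list `ws` makes the image of the arbitrary type `W` decidable.
      image? : Unary.Decidable (λ v → Any.Any (λ w → f w ≡ v) ws)
      image? v = Any.any? (λ w → f w Fin.≟ v) ws

      S : Subset n
      S = tabulate (does ∘ image?)

      preimage : (v : ∃ λ v → v ∈ S) → ∃ λ w → f w ≡ proj₁ v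
      preimage (_ , v∈S) = Any.satisfied (∈-tabulate⁻ image? v∈S)

      image : W → ∃ λ v → v ∈ S
      image w = f w , ∈-tabulate⁺ image? (Any.map (λ { refl → refl }) (complete w))

      vertex-≡ : {u v : ∃ λ v → v ∈ S} → proj₁ u ≡ proj₁ v → u ≡ v
      vertex-≡ {_ , p} {_ , q} refl with refl ← []=-irrelevant p q = refl

      iso : (∃ λ v → v ∈ S) ↔ W
      iso = mk↔ₛ′ (proj₁ ∘ preimage) image
                  (λ w → injective (proj₂ (preimage (image w))))
                  (λ v → vertex-≡ (proj₂ (preimage v)))

      iso-edge : ∀ u v → induced G S [ u ~ v ] ⇔
                         H [ proj₁ (preimage u) ~ proj₁ (preimage v) ]
      iso-edge u v with i , fi≡u ← preimage u | j , fj≡v ← preimage v =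
        subst₂ (λ s t → s ~ t ⇔ H [ i ~ j ]) fi≡u fj≡v (adjacent i j)

  -- If `u` and `v` coincided, `v ≃ w` would contradict `u ≄ w`. This turns sides of closed walks
  -- into edges.
  ~-by : ∀ {u v w} → u ≃ v → u ≄ w → v ≃ w → u ~ v
  ~-by (edge u~v) _ _ = u~v
  ~-by refl u≄w u≃w = contradiction u≃w u≄w

  -- Short closed walks

  module _ (C₄-free : G isFreeOf C 4) where

    square : ∀ {p q r s} → p ≃ q → q ≃ r → r ≃ s → s ≃ p → p ≄ r → q ≄ s → ⊥
    square {p} {q} {r} {s} pq qr rs sp p≄r q≄s =
      free⇒¬AllPairs (C 4) (lookup (p ∷ q ∷ r ∷ s ∷ [])) C₄-free ∈-allFin
        ( (~-by pq p≄r qr ∷ p≄r ∷ ~-sym (~-by sp (≄-sym q≄s) pq) ∷ [])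
        ∷ (~-by qr q≄s rs ∷ q≄s ∷ [])
        ∷ (~-by rs (≄-sym p≄r) sp ∷ [])
        ∷ [] ∷ [])

    module _ (C₅-free : G isFreeOf C 5) where

      -- Of the five diagonals, `q s` and `r t` are left open: either one would shorten the walk to
      -- a `square`, and without them it is an induced C₅.
      pentagon : ∀ {p q r s t} → p ≃ q → q ≃ r → r ≃ s → s ≃ t → t ≃ p →
                 p ≄ r → p ≄ s → q ≄ t → ⊥
      pentagon {p} {q} {r} {s} {t} pq qr rs st tp p≄r p≄s q≄t
        with q ≃? s | r ≃? t
      ... | yes qs | _      = square pq qs st tp p≄s q≄t
      ... | no _   | yes rt = square pq qr rt tp p≄r q≄t
      ... | no q≄s | no r≄t =
        free⇒¬AllPairs (C 5) (lookup (p ∷ q ∷ r ∷ s ∷ t ∷ [])) C₅-free ∈-allFin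
          ( (~-by pq p≄r qr ∷ p≄r ∷ p≄s ∷ ~-sym (~-by tp (≄-sym q≄t) pq) ∷ [])
          ∷ (~-by qr q≄s rs ∷ q≄s ∷ q≄t ∷ [])
          ∷ (~-by rs r≄t st ∷ r≄t ∷ [])
          ∷ (~-by st (≄-sym p≄s) tp ∷ [])
          ∷ [] ∷ [])

      record Hexagon (p q r s t u : Fin n) : Set where
        constructor hexagon
        field
          pq : p ≃ q
          qr : q ≃ r
          rs : r ≃ s
          st : s ≃ t
          tu : t ≃ u
          up : u ≃ p
          p≄s : p ≄ s
          q≄t : q ≄ t
          r≄u : r ≄ u

      rotate : ∀ {p q r s t u} → Hexagon p q r s t u → Hexagon q r s t u p
      rotate (hexagon pq qr rs st tu up p≄s q≄t r≄u) =
        hexagon qr rs st tu up pq q≄t r≄u (≄-sym p≄s)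

      -- The chord bypasses `q`, leaving the closed walk r p u t s, which `pentagon` excludes if
      -- `r ≄ t`.
      chord : ∀ {p q r s t u} → Hexagon p q r s t u → p ≃ r → r ≃ t
      chord {r = r} {t = t} (hexagon pq qr rs st tu up p≄s q≄t r≄u) pr
        with r ≃? t
      ... | yes rt = rt
      ... | no r≄t = ⊥-elim
        (pentagon (≃-sym pr) (≃-sym up) (≃-sym tu) (≃-sym st) (≃-sym rs)
                  r≄u r≄t p≄s)

      -- Both chords together would bypass `r` and `u`, leaving the square p q s t.
      no-opposite-chord : ∀ {p q r s t u} → Hexagon p q r s t u →
                          t ≃ p → q ≄ s
      no-opposite-chord (hexagon pq qr rs st tu up p≄s q≄t r≄u) tp qs =
        square pq qs st tp p≄s q≄t

      module _ (C₆-free : G isFreeOf C 6) (S₃-free : G isFreeOf S₃) where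

        sunVertices : List SunVertex
        sunVertices = a zero ∷ a (suc zero) ∷ a (suc (suc zero)) ∷
                      b zero ∷ b (suc zero) ∷ b (suc (suc zero)) ∷ []

        ∈-sunVertices : ∀ w → w List.∈ sunVertices
        ∈-sunVertices (a zero)             = here refl
        ∈-sunVertices (a (suc zero))       = there (here refl)
        ∈-sunVertices (a (suc (suc zero))) = there (there (here refl))
        ∈-sunVertices (b zero)             = there (there (there (here refl)))
        ∈-sunVertices (b (suc zero))       = there (there (there (there (here refl))))
        ∈-sunVertices (b (suc (suc zero))) =
          there (there (there (there (there (here refl)))))

        -- Applying `chord` repeatedly makes p, r, t a triangle; its sides in turn keep q, s, u
        -- pairwise nonadjacent, which gives a 3-sun.
        no-chord : ∀ {p q r s t u} → Hexagon p q r s t u → p ≄ r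
        no-chord {p} {q} {r} {s} {t} {u} h₀ pr =
          free⇒¬AllPairs S₃ sun S₃-free ∈-sunVertices
            ( (~-by pr p≄s rs ∷ ~-sym (~-by tp (≄-sym q≄t) pq)
                ∷ p≄s ∷ ~-sym (~-by up (≄-sym r≄u) pr)
                ∷ ~-sym (~-by (≃-sym pq) q≄t (≃-sym tp)) ∷ [])
            ∷ (~-by rt r≄u tu
                ∷ ~-sym (~-by (≃-sym rs) (≄-sym p≄s) (≃-sym pr)) ∷ r≄u
                ∷ ~-sym (~-by qr q≄t rt) ∷ [])
            ∷ (~-sym (~-by st (≄-sym p≄s) tp)
                ∷ ~-sym (~-by (≃-sym tu) (≄-sym r≄u) (≃-sym rt)) ∷ ≄-sym q≄t ∷ [])
            ∷ (s≄u ∷ ≄-sym q≄s ∷ [])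
            ∷ (u≄q ∷ [])
            ∷ [] ∷ [])
          where
          h₂ = rotate (rotate h₀)
          h₄ = rotate (rotate h₂)
          open Hexagon h₀
          rt = chord h₀ pr
          tp = chord h₂ rt
          q≄s = no-opposite-chord h₀ tp
          s≄u = no-opposite-chord h₂ pr
          u≄q = no-opposite-chord h₄ rt

          sun : SunVertex → Fin n
          sun (a i) = lookup (p ∷ r ∷ t ∷ []) i
          -- `b i` must miss `a i` only, so it is the vertex opposite to `a i` in the hexagon.
          sun (b i) = lookup (s ∷ u ∷ q ∷ []) i

        no-hexagon : ∀ {p q r s t u} → ¬ Hexagon p q r s t u
        no-hexagon {p} {q} {r} {s} {t} {u} h₀ =
          free⇒¬AllPairs (C 6) (lookup (p ∷ q ∷ r ∷ s ∷ t ∷ u ∷ [])) C₆-free ∈-allFin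
            ( (~-by pq p≄r qr ∷ p≄r ∷ p≄s ∷ ≄-sym t≄p ∷ ~-sym (~-by up u≄q pq) ∷ [])
            ∷ (~-by qr q≄s rs ∷ q≄s ∷ q≄t ∷ ≄-sym u≄q ∷ [])
            ∷ (~-by rs r≄t st ∷ r≄t ∷ r≄u ∷ [])
            ∷ (~-by st s≄u tu ∷ s≄u ∷ [])
            ∷ (~-by tu t≄p up ∷ [])
            ∷ [] ∷ [])
          where
          -- The six rotations exclude each chord between vertices two steps apart; opposite
          -- vertices are excluded by the hexagon itself.
          h₁ = rotate h₀
          h₂ = rotate h₁
          h₃ = rotate h₂
          h₄ = rotate h₃
          h₅ = rotate h₄
          open Hexagon h₀
          p≄r = no-chord h₀
          q≄s = no-chord h₁
          r≄t = no-chord h₂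
          s≄u = no-chord h₃
          t≄p = no-chord h₄
          u≄q = no-chord h₅

        triple : ∀ {u v w x y z} → u ≃ y → u ≃ z → v ≃ x → v ≃ z → w ≃ x → w ≃ y →
                 u ≃ x ⊎ v ≃ y ⊎ w ≃ z
        triple {u} {v} {w} {x} {y} {z} uy uz vx vz wx wy
          with u ≃? x | v ≃? y | w ≃? z
        ... | yes ux | _      | _      = inj₁ ux
        ... | no _   | yes vy | _      = inj₂ (inj₁ vy)
        ... | no _   | no _   | yes wz = inj₂ (inj₂ wz)
        ... | no u≄x | no v≄y | no w≄z = contradiction
          (hexagon (≃-sym wx) wy (≃-sym uy) uz (≃-sym vz) vx
                   (≄-sym u≄x) w≄z (≄-sym v≄y))
          no-hexagon

  square-clique⇒common : ∀ {K} → IsClique (G ²) K →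
    ∀ {x y} → x ∈ K → y ∈ K → ∃ λ v → v ≃ x × v ≃ y
  square-clique⇒common clique {x} {y} x∈K y∈K with x Fin.≟ y
  -- `IsClique` is silent about equal vertices, but `helly` asks about them too.
  ... | yes refl = x , refl , refl
  ... | no  x≢y  = distance≤2⇒common (proj₂ (clique x∈K y∈K x≢y))

theorem3p2 : ∀ {n : ℕ} (G : Graph (Fin n)) →
    G isFreeOf C 4 → G isFreeOf C 5 → G isFreeOf C 6 → G isFreeOf S₃ →
    ∀ (K : Subset n) → Nonempty K → IsClique (G ²) K →
    ∃ λ (v : Fin n) → K ⊆ N[ G ] v
theorem3p2 {n} G C₄-free C₅-free C₆-free S₃-free K (x , x∈K) clique =
  v , λ {w} w∈K → ≃⇒∈N G
    -- The two `there` skip the leading copies of `x`.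
    (All.lookup dominated (there (there (∈-filter⁺ (_∈? K) (∈-allFin w) w∈K))))
  where
  -- The list must start with two elements; x serves twice.
  domination = helly (_≃_ G) (triple G C₄-free C₅-free C₆-free S₃-free) (_∈ K)
    (square-clique⇒common G clique)
    (x∈K ∷ x∈K ∷ all-filter (_∈? K) (allFin n))
  v = proj₁ domination
  dominated = proj₂ domination
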